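{- Let $\langle A,\to\rangle$ be a conditional algebra. Then for all $U,V\subseteq\mathrm{Ul}(A)$, $$U\to_{T_A}V=\bigcap_{(Y,O)}\ \bigcup_{\substack{a,b\in A\\ Y\subseteq\varphi(a),\ \varphi(b)\subseteq O}}\varphi(a\to b),$$ where $(Y,O)$ ranges over all pairs with $Y$ a closed subset of the Stone space of $A$ with $Y\subseteq U$ and $O$ an open subset with $V\subseteq O$; i.e., $\to_{T_A}$ is the $\pi$-extension of $\to$ to the canonical extension $\mathcal{P}(\mathrm{Ul}(A))$ of $A$. Moreover, $\langle\mathcal{P}(\mathrm{Ul}(A)),\to_{T_A}\rangle$ is a conditional algebra, so the variety of conditional algebras is closed under canonical extensions.
   Context: A conditional algebra is a pair $\langle A,\to\rangle$ where $A$ is a Boolean algebra and $\to$ is a binary operation on $A$ such that for all $a,b,c$: $a\to 1=1$; $(a\to b)\wedge(a\to c)=a\to(b\wedge c)$; $(a\vee b)\to c\le (a\to c)\wedge(b\to c)$. $\mathrm{Ul}(A)$ is the set of ultrafilters of $A$ with the Stone topology, $\varphi(a)=\{u: a\in u\}$. Filters include the improper filter $A$, and for a filter $F$, $\varphi(F)=\{u\in\mathrm{Ul}(A): F\subseteq u\}$. For $X,Y\subseteq A$, $D^{\to}_X(Y)=\{b\in A:\exists a\in Y,\ a\to b\in X\}$. $T_A(u,Z,v)$ holds iff there is a filter $F$ with $Z=\varphi(F)$ and $D^{\to}_u(F)\subseteq v$; $T_A(u,Z)=\{v:T_A(u,Z,v)\}$. For $U,V\subseteq\mathrm{Ul}(A)$,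 $U\to_{T_A}V=\{u: \text{for all } Z\subseteq U,\ T_A(u,Z)\subseteq V\}$. The canonical extension of $A$ is identified with $\mathcal{P}(\mathrm{Ul}(A))$ via $\varphi$. -}

module Defs where

open import Algebra.Core using (Op₂)
open import Algebra.Lattice.Bundles using (BooleanAlgebra)
open import Axiom.ExcludedMiddle using (ExcludedMiddle)
open import Axiom.Extensionality.Propositional using (Extensionality)
open import Data.Empty.Polymorphic using (⊥)
open import Data.Product.Base using (Σ-syntax; ∃-syntax; _×_; _,_; proj₁; proj₂)
import Data.Product.Base as Product
open import Data.Sum.Base using (inj₁; inj₂)
import Data.Sum.Base as Sum
open import Data.Unit.Polymorphic using (⊤; tt)
open import Level using (Level; Setω; Lift; lift; _⊔_; suc)
open import Relation.Binary.Bundles using (Setoid)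
open import Relation.Binary.Definitions using (_Respects_)
import Relation.Binary.Construct.NaturalOrder.Left as NaturalOrder
open import Relation.Nullary.Decidable using (True; toWitness; fromWitness; yes; no)
open import Relation.Nullary.Negation using (contradiction)
open import Relation.Unary using (Pred; _∈_; _∉_; _⊆_; _≐_; _∪_; _∩_; ∁)
import Relation.Unary.Algebra as Unary

-- The classical metatheory.  Excluded middle is assumed for all types, not
-- just propositions, so it also selects an element of every nonempty type;
-- function extensionality makes this selection independent of how a
-- (Bool-valued) subset is presented.  Together they yield the axiom of choice
-- in the usual, extensional sense.
record Classical : Setω where
  field
    em  : ∀ {a} → ExcludedMiddle a
    ext : ∀ {a b} → Extensionality a b

module _ {c ℓ} (B : BooleanAlgebra c ℓ) where
  open BooleanAlgebra B
    using (Carrier; _≈_; _∧_; _∨_) renaming (⊤ to 𝟙)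
  open NaturalOrder _≈_ _∧_ using (_≤_)

  record IsConditionalAlgebra (_⇒_ : Op₂ Carrier) : Set (c ⊔ ℓ) where
    field
      ⇒-cong  : ∀ {a a′ b b′} → a ≈ a′ → b ≈ b′ → (a ⇒ b) ≈ (a′ ⇒ b′)
      ⇒-top   : ∀ a → (a ⇒ 𝟙) ≈ 𝟙
      ⇒-meet  : ∀ a b d → ((a ⇒ b) ∧ (a ⇒ d)) ≈ (a ⇒ (b ∧ d))
      ⇒-join  : ∀ a b d → ((a ∨ b) ⇒ d) ≤ ((a ⇒ d) ∧ (b ⇒ d))

record ConditionalAlgebra c ℓ : Set (suc (c ⊔ ℓ)) where
  infixr 5 _⇒_
  field
    booleanAlgebra       : BooleanAlgebra c ℓ
  open BooleanAlgebra booleanAlgebra public using (Carrier)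
  field
    _⇒_                  : Op₂ Carrier
    isConditionalAlgebra : IsConditionalAlgebra booleanAlgebra _⇒_

-- Subsets of a set presented as a setoid: predicates that respect its equality.
module Powerset {a r} (X : Setoid a r) where
  open Setoid X using (sym) renaming (Carrier to ∣X∣; _≈_ to _≈ₓ_)

  record Subset (p : Level) : Set (a ⊔ r ⊔ suc p) where
    field
      ⟦_⟧  : Pred ∣X∣ p
      resp : ⟦_⟧ Respects _≈ₓ_
  open Subset public

  complement : ∀ {p} → Subset p → Subset p
  complement U = record
    { ⟦_⟧  = ∁ ⟦ U ⟧
    ; resp = λ x≈y x∉U y∈U → x∉U (resp U (sym x≈y) y∈U)
    }

  module _ (𝒞 : Classical) where
    open Classical 𝒞

    -- Classically every truth value has a copy in every universe; this lets
    -- a subset defined by quantifying over subsets be a subset again.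
    resize : ∀ {p} q → Subset p → Subset q
    resize q U = record
      { ⟦_⟧  = λ x → Lift q (True (em {P = ⟦ U ⟧ x}))
      ; resp = λ x≈y (lift t) → lift (fromWitness (resp U x≈y (toWitness t)))
      }

    powersetAlgebra : ∀ p → BooleanAlgebra (a ⊔ r ⊔ suc p) (a ⊔ p)
    powersetAlgebra p = record
      { Carrier = Subset p
      ; _≈_     = λ U V → ⟦ U ⟧ ≐ ⟦ V ⟧
      ; _∨_     = λ U V → record
          { ⟦_⟧  = ⟦ U ⟧ ∪ ⟦ V ⟧
          ; resp = λ e → Sum.map (resp U e) (resp V e) }
      ; _∧_     = λ U V → record
          { ⟦_⟧  = ⟦ U ⟧ ∩ ⟦ V ⟧
          ; resp = λ e → Product.map (resp U e) (resp V e) }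
      ; ¬_      = complement
      ; ⊤       = record { ⟦_⟧ = λ _ → ⊤ ; resp = λ _ _ → tt }
      ; ⊥       = record { ⟦_⟧ = λ _ → ⊥ ; resp = λ _ () }
      ; isBooleanAlgebra = record
        { isDistributiveLattice = record
          { isLattice = record
            { isEquivalence = record
              { refl  = (λ u → u) , (λ u → u)
              ; sym   = Product.swap
              ; trans = λ (f , g) (h , k) → (λ u → h (f u)) , (λ u → g (k u)) }
            ; ∨-comm     = λ U V → Unary.∪-comm ⟦ U ⟧ ⟦ V ⟧
            ; ∨-assoc    = λ U V W → Unary.∪-assoc ⟦ U ⟧ ⟦ V ⟧ ⟦ W ⟧
            ; ∨-cong     = Unary.∪-cong
            ; ∧-comm     = λ U V → Unary.∩-comm ⟦ U ⟧ ⟦ V ⟧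
            ; ∧-assoc    = λ U V W → Unary.∩-assoc ⟦ U ⟧ ⟦ V ⟧ ⟦ W ⟧
            ; ∧-cong     = Unary.∩-cong
            ; absorptive = (λ U V → Unary.∪-abs-∩ ⟦ U ⟧ ⟦ V ⟧)
                         , (λ U V → Unary.∩-abs-∪ ⟦ U ⟧ ⟦ V ⟧)
            }
          ; ∨-distrib-∧ = (λ U V W → Unary.∪-distribˡ-∩ ⟦ U ⟧ ⟦ V ⟧ ⟦ W ⟧)
                        , (λ U V W → Unary.∪-distribʳ-∩ ⟦ U ⟧ ⟦ V ⟧ ⟦ W ⟧)
          ; ∧-distrib-∨ = (λ U V W → Unary.∩-distribˡ-∪ ⟦ U ⟧ ⟦ V ⟧ ⟦ W ⟧)
                        , (λ U V W → Unary.∩-distribʳ-∪ ⟦ U ⟧ ⟦ V ⟧ ⟦ W ⟧)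
          }
        ; ∨-complement = (λ U → (λ _ → tt) , (λ {x} _ → Sum.swap (decide U x)))
                       , (λ U → (λ _ → tt) , (λ {x} _ → decide U x))
        ; ∧-complement = (λ U → (λ (x∉U , x∈U) → contradiction x∈U x∉U) , (λ ()))
                       , (λ U → (λ (x∈U , x∉U) → contradiction x∈U x∉U) , (λ ()))
        ; ¬-cong       = λ (f , g) → (λ x∉U y → x∉U (g y)) , (λ x∉V y → x∉V (f y))
        }
      }
      where
      decide : (U : Subset p) → ∀ x → (⟦ U ⟧ ∪ ∁ ⟦ U ⟧) x
      decide U x with em {P = ⟦ U ⟧ x}
      ... | yes x∈U = inj₁ x∈U
      ... | no  x∉U = inj₂ x∉U

module Stone {c ℓ} (B : BooleanAlgebra c ℓ) where
  open BooleanAlgebra B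
    using (Carrier; _≈_; _∧_) renaming (⊤ to 𝟙; ⊥ to 𝟘)
  open NaturalOrder _≈_ _∧_ using (_≤_)

  -- The improper filter is allowed.
  record Filter : Set (suc (c ⊔ ℓ)) where
    field
      ∣_∣      : Pred Carrier (c ⊔ ℓ)
      top      : 𝟙 ∈ ∣_∣
      meet     : ∀ {a b} → a ∈ ∣_∣ → b ∈ ∣_∣ → (a ∧ b) ∈ ∣_∣
      upClosed : ∀ {a b} → a ≤ b → a ∈ ∣_∣ → b ∈ ∣_∣
  open Filter public using (∣_∣)

  Proper : Filter → Set (c ⊔ ℓ)
  Proper F = 𝟘 ∉ ∣ F ∣

  record Ultrafilter : Set (suc (c ⊔ ℓ)) where
    field
      filter  : Filter
      proper  : Proper filter
      maximal : ∀ G → Proper G → ∣ filter ∣ ⊆ ∣ G ∣ → ∣ G ∣ ⊆ ∣ filter ∣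

  elems : Ultrafilter → Pred Carrier (c ⊔ ℓ)
  elems u = ∣ Ultrafilter.filter u ∣

  Ul : Setoid (suc (c ⊔ ℓ)) (c ⊔ ℓ)
  Ul = record
    { Carrier       = Ultrafilter
    ; _≈_           = λ u v → elems u ≐ elems v
    ; isEquivalence = record
      { refl  = (λ x → x) , (λ x → x)
      ; sym   = Product.swap
      ; trans = λ (f , g) (h , k) → (λ x → h (f x)) , (λ x → g (k x))
      }
    }

  open Powerset Ul public

  𝒫Ul : Set (suc (c ⊔ ℓ))
  𝒫Ul = Subset (c ⊔ ℓ)

  φ : Carrier → 𝒫Ul
  φ a = record { ⟦_⟧ = λ u → a ∈ elems u ; resp = λ u≈v → proj₁ u≈v }

  φᶠ : Filter → 𝒫Ul
  φᶠ F = record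
    { ⟦_⟧  = λ u → ∣ F ∣ ⊆ elems u
    ; resp = λ u≈v F⊆u x → proj₁ u≈v (F⊆u x)
    }

  -- The topology with basis { φ a }.
  IsOpen : 𝒫Ul → Set (suc (c ⊔ ℓ))
  IsOpen O = ∀ {u} → u ∈ ⟦ O ⟧ → ∃[ a ] (u ∈ ⟦ φ a ⟧ × ⟦ φ a ⟧ ⊆ ⟦ O ⟧)

  IsClosed : 𝒫Ul → Set (suc (c ⊔ ℓ))
  IsClosed Y = IsOpen (complement Y)

  -- The π-extension of a binary operation that is antitone in its first and
  -- monotone in its second argument: the intersection, over closed Y ⊆ U and
  -- open O ⊇ V, of the union of φ (f a b) over Y ⊆ φ a and φ b ⊆ O.
  πExtension : Op₂ Carrier → 𝒫Ul → 𝒫Ul → Subset (suc (c ⊔ ℓ))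
  πExtension f U V = record
    { ⟦_⟧  = λ u → ∀ Y O → IsClosed Y → ⟦ Y ⟧ ⊆ ⟦ U ⟧ → IsOpen O → ⟦ V ⟧ ⊆ ⟦ O ⟧ →
               ∃[ a ] ∃[ b ] (⟦ Y ⟧ ⊆ ⟦ φ a ⟧ × ⟦ φ b ⟧ ⊆ ⟦ O ⟧ × u ∈ ⟦ φ (f a b) ⟧)
    ; resp = λ u≈v h Y O cY Y⊆U oO V⊆O →
               let (a , b , p , q , r) = h Y O cY Y⊆U oO V⊆O
               in a , b , p , q , proj₁ u≈v r
    }

module Canonical {c ℓ} (𝔸 : ConditionalAlgebra c ℓ) where
  open ConditionalAlgebra 𝔸
  open Stone booleanAlgebra public

  D : Pred Carrier (c ⊔ ℓ) → Pred Carrier (c ⊔ ℓ) → Pred Carrier (c ⊔ ℓ)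
  D X Y b = ∃[ a ] (a ∈ Y × (a ⇒ b) ∈ X)

  T : Ultrafilter → 𝒫Ul → Pred Ultrafilter (suc (c ⊔ ℓ))
  T u Z v = Σ[ F ∈ Filter ] (⟦ Z ⟧ ≐ ⟦ φᶠ F ⟧ × D (elems u) ∣ F ∣ ⊆ elems v)

  _⇒ₜ_ : 𝒫Ul → 𝒫Ul → Subset (suc (c ⊔ ℓ))
  U ⇒ₜ V = record
    { ⟦_⟧  = λ u → ∀ Z → ⟦ Z ⟧ ⊆ ⟦ U ⟧ → T u Z ⊆ ⟦ V ⟧
    ; resp = λ u≈u′ h Z Z⊆U (F , Z≐φF , D⊆v) →
               h Z Z⊆U (F , Z≐φF , λ (a , a∈F , r) → D⊆v (a , a∈F , proj₁ u≈u′ r))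
    }

  _⇒π_ : 𝒫Ul → 𝒫Ul → Subset (suc (c ⊔ ℓ))
  _⇒π_ = πExtension _⇒_

  module _ (𝒞 : Classical) where

    𝒫UlAlgebra : BooleanAlgebra (suc (c ⊔ ℓ)) (suc (c ⊔ ℓ))
    𝒫UlAlgebra = powersetAlgebra 𝒞 (c ⊔ ℓ)

    ⇒ₜ-op : Op₂ 𝒫Ul
    ⇒ₜ-op U V = resize 𝒞 (c ⊔ ℓ) (U ⇒ₜ V)

    ⇒π-op : Op₂ 𝒫Ul
    ⇒π-op U V = resize 𝒞 (c ⊔ ℓ) (U ⇒π V)

{-# OPTIONS --safe #-}

-- Two separation arguments give the equation.  Given closed Y ⊆ U and open
-- O ⊇ V, let F = { a ∣ Y ⊆ φ a }, so that Y = φ F.  Then D u F is a filter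
-- and T u Y = φ (D u F), so u ∈ U ⇒ₜ V means φ (D u F) ⊆ V ⊆ O, and by
-- compactness some b ∈ D u F has φ b ⊆ O.  Conversely, if D u F ⊆ v and
-- v ∉ V, the pair (φ F , ∁ { v }) yields a, b with a ∈ F and a ⇒ b ∈ u, hence
-- b ∈ v, against φ b ⊆ ∁ { v }.  The axioms of conditional algebras are
-- immediate for ⇒ₜ.  Compactness rests on the ultrafilter theorem, which is
-- derived from Zorn's lemma.
module Submission where

open import Defs
open import Algebra.Core using (Op₂)
open import Algebra.Lattice.Bundles using (BooleanAlgebra)
import Algebra.Lattice.Properties.BooleanAlgebra as BooleanAlgebraProperties
open import Data.Bool.Base using (Bool; T)
open import Data.Empty using (⊥-elim)
open import Data.Product.Base using (Σ-syntax; ∃-syntax; _×_; _,_; proj₁; proj₂)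
open import Data.Sum.Base using (_⊎_; inj₁; inj₂; [_,_])
open import Data.Unit.Polymorphic using (tt)
open import Function.Base using (_∘_; id)
open import Level using (Lift; lift; lower; _⊔_; suc)
open import Relation.Binary.Bundles using (Setoid)
open import Relation.Binary.Lattice using (Lattice)
open import Relation.Binary.PropositionalEquality.Core using (_≡_; refl)
open import Relation.Nullary.Decidable using (Dec; yes; no; isYes; toWitness; fromWitness; decidable-stable)
open import Relation.Nullary.Negation using (¬_; contradiction)
open import Relation.Nullary.Reflects using (det; fromEquivalence; T-reflects)
open import Relation.Unary using (Pred; _∈_; _∉_; _⊆_; _⊆′_; _≐_)

-- The axioms are checked on `⇒ₜ-op`, where they are direct, and carried over to `⇒π-op` by this
-- transport.
isConditionalAlgebra-resp : ∀ {c ℓ} (B : BooleanAlgebra c ℓ) →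
  let open BooleanAlgebra B in {_⇒_ _⇒′_ : Op₂ Carrier} →
  (∀ a b → (a ⇒ b) ≈ (a ⇒′ b)) →
  IsConditionalAlgebra B _⇒_ → IsConditionalAlgebra B _⇒′_
isConditionalAlgebra-resp B {_⇒_} {_⇒′_} ⇒≈⇒′ isCA = record
  { ⇒-cong = λ {a} {a′} {b} {b′} p q →
      trans (sym (⇒≈⇒′ a b)) (trans (⇒-cong p q) (⇒≈⇒′ a′ b′))
  ; ⇒-top  = λ a → trans (sym (⇒≈⇒′ a ⊤)) (⇒-top a)
  ; ⇒-meet = λ a b d →
      trans (∧-cong (sym (⇒≈⇒′ a b)) (sym (⇒≈⇒′ a d)))
            (trans (⇒-meet a b d) (⇒≈⇒′ a (b ∧ d)))
  ; ⇒-join = λ a b d →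
      trans (sym (⇒≈⇒′ (a ∨ b) d))
            (trans (⇒-join a b d)
                   (∧-cong (⇒≈⇒′ (a ∨ b) d) (∧-cong (⇒≈⇒′ a d) (⇒≈⇒′ b d))))
  }
  where
  open BooleanAlgebra B
  open IsConditionalAlgebra isCA

module _ (𝒞 : Classical) where
  open Classical 𝒞

  by-contradiction : ∀ {p} {P : Set p} → ¬ ¬ P → P
  by-contradiction = decidable-stable em

  -- A copy of the truth value of P at level q.
  record Small {p} q (P : Set p) : Set q where
    constructor small
    field holds : T (isYes (em {P = P}))

  toSmall : ∀ {p q} {P : Set p} → P → Small q P
  toSmall h = small (fromWitness h)

  fromSmall : ∀ {p q} {P : Set p} → Small q P → P
  fromSmall (small h) = toWitness h

  -- Zorn's lemma for families of `Bool`-valued subsets.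

  module _ {x} {X : Set x} where

    char : ∀ {p} → Pred X p → X → Bool
    char P y = isYes (em {P = P y})

    infix 4 _⊑_
    _⊑_ : (X → Bool) → (X → Bool) → Set x
    S ⊑ S′ = ∀ y → T (S y) → T (S′ y)

    ⊑-antisym : ∀ {S S′} → S ⊑ S′ → S′ ⊑ S → S ≡ S′
    ⊑-antisym S⊑S′ S′⊑S = ext λ y →
      det (T-reflects _) (fromEquivalence (S′⊑S y) (S⊑S′ y))

    ⋃ : ((X → Bool) → Bool) → X → Bool
    ⋃ P = char λ y → ∃[ S ] (T (P S) × T (S y))

    ⊑-⋃ : ∀ P {S} → T (P S) → S ⊑ ⋃ P
    ⊑-⋃ P S∈P y y∈S = fromWitness (_ , S∈P , y∈S)

    ⋃-⊑ : ∀ P {S} → (∀ {S′} → T (P S′) → S′ ⊑ S) → ⋃ P ⊑ S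
    ⋃-⊑ P bound y y∈⋃ = let (_ , S∈P , y∈S) = toWitness y∈⋃ in bound S∈P y y∈S

    IsChain : ((X → Bool) → Bool) → Set x
    IsChain P = ∀ {S S′} → T (P S) → T (P S′) → S ⊑ S′ ⊎ S′ ⊑ S

    -- The Bourbaki–Witt argument: iterate a chosen strict enlargement
    -- transfinitely.  The enlargement need not be monotone, but it is a
    -- function of Bool-valued subsets, so by extensionality it sends
    -- coextensive subsets to equal ones.
    module Zorn {q} (Q : Pred (X → Bool) q)
                (chain-closed : ∀ P → ∃[ S ] T (P S) → (∀ {S} → T (P S) → Q S) →
                                IsChain P → Q (⋃ P))
                (S₀ : X → Bool) (QS₀ : Q S₀) where

      Enlargement : (X → Bool) → Set (x ⊔ q)
      Enlargement S = ∃[ S′ ] (Q S′ × S ⊑ S′ × ¬ S′ ⊑ S)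

      -- The decision is an argument, so that facts about `next` can be proved by matching on it.
      enlarge : ∀ S → Dec (Enlargement S) → X → Bool
      enlarge S (yes (S′ , _)) = S′
      enlarge S (no _)         = S

      next : (X → Bool) → X → Bool
      next S = enlarge S em

      ⊑-next : ∀ S → S ⊑ next S
      ⊑-next S = go em
        where
        go : ∀ d → S ⊑ enlarge S d
        go (yes (_ , _ , S⊑S′ , _)) = S⊑S′
        go (no _)                   = λ _ → id

      Q-next : ∀ S → Q S → Q (next S)
      Q-next S QS = go em
        where
        go : ∀ d → Q (enlarge S d)
        go (yes (_ , QS′ , _)) = QS′
        go (no _)              = QS

      -- Whenever a strict enlargement exists, `next` picks one, so a point that `next` does not
      -- enlarge has none.
      next⊑⇒maximal : ∀ S → next S ⊑ S → ∀ N → Q N → S ⊑ N → N ⊑ S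
      next⊑⇒maximal S = go em
        where
        go : ∀ d → enlarge S d ⊑ S → ∀ N → Q N → S ⊑ N → N ⊑ S
        go (yes (_ , _ , _ , S′⋢S)) S′⊑S = contradiction S′⊑S S′⋢S
        go (no none) _ N QN S⊑N = by-contradiction λ N⋢S → none (N , QN , S⊑N , N⋢S)

      -- `sup` admits arbitrary nonempty families; that they are chains is a consequence,
      -- `tower-total`. Since families are `Bool`-valued, the tower can itself be presented as one
      -- of them.
      data Tower : Pred (X → Bool) x where
        base : Tower S₀
        succ : ∀ {S} → Tower S → Tower (next S)
        sup  : ∀ P → ∃[ S ] T (P S) → (∀ {S} → T (P S) → Tower S) → Tower (⋃ P)

      base-⊑ : ∀ {S} → Tower S → S₀ ⊑ S
      base-⊑ base                   y y∈S₀ = y∈S₀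
      base-⊑ (succ t)               y y∈S₀ = ⊑-next _ y (base-⊑ t y y∈S₀)
      base-⊑ (sup P (_ , S∈P) P⊆T)  y y∈S₀ = ⊑-⋃ P S∈P y (base-⊑ (P⊆T S∈P) y y∈S₀)

      -- Comparability with a gap: nothing in the tower falls strictly between `S′` and `next S′`.
      -- Plain comparability would not survive the `succ` step, as `next` need not be monotone.
      _≼_ : (X → Bool) → (X → Bool) → Set x
      S ≼ S′ = S ⊑ S′ ⊎ next S′ ⊑ S

      ≼-next : ∀ {S S′} → S ≼ S′ → S′ ≼ S → next S ≼ S′
      ≼-next (inj₂ nS′⊑S) _            = inj₂ λ y y∈ → ⊑-next _ y (nS′⊑S y y∈)
      ≼-next (inj₁ _)     (inj₂ nS⊑S′) = inj₁ nS⊑S′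
      ≼-next (inj₁ S⊑S′)  (inj₁ S′⊑S) with refl ← ⊑-antisym S⊑S′ S′⊑S = inj₂ λ _ → id

      -- Either one member of `P` already contains `next S`, or every member stays below `S`.
      ≼-⋃ : ∀ P {S} → (∀ {S′} → T (P S′) → S′ ≼ S) → ⋃ P ≼ S
      ≼-⋃ P {S} all≼ with em {P = ∃[ S′ ] (T (P S′) × next S ⊑ S′)}
      ... | yes (_ , S′∈P , nS⊑S′) = inj₂ λ y y∈ → ⊑-⋃ P S′∈P y (nS⊑S′ y y∈)
      ... | no  none               = inj₁ (⋃-⊑ P below)
        where
        below : ∀ {S′} → T (P S′) → S′ ⊑ S
        below S′∈P with all≼ S′∈P
        ... | inj₁ S′⊑S  = S′⊑S
        ... | inj₂ nS⊑S′ = contradiction (_ , S′∈P , nS⊑S′) none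

      mutual
        -- Both orientations are proved together because `≼-next` consumes both at the predecessor.
        -- Each call shrinks one derivation and keeps the other.
        ≼-total : ∀ {S S′} → Tower S → Tower S′ → S ≼ S′
        ≼-total base            t′ = inj₁ (base-⊑ t′)
        ≼-total (succ t)        t′ = ≼-next (≼-total t t′) (≼-total′ t t′)
        ≼-total (sup P _ P⊆T)   t′ = ≼-⋃ P λ S∈P → ≼-total (P⊆T S∈P) t′

        ≼-total′ : ∀ {S S′} → Tower S → Tower S′ → S′ ≼ S
        ≼-total′ t base          = inj₁ (base-⊑ t)
        ≼-total′ t (succ t′)     = ≼-next (≼-total′ t t′) (≼-total t t′)
        ≼-total′ t (sup P _ P⊆T) = ≼-⋃ P λ S∈P → ≼-total′ t (P⊆T S∈P)

      tower-total : ∀ {S S′} → Tower S → Tower S′ → S ⊑ S′ ⊎ S′ ⊑ S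
      tower-total t t′ with ≼-total t t′
      ... | inj₁ S⊑S′  = inj₁ S⊑S′
      ... | inj₂ nS′⊑S = inj₂ λ y y∈ → nS′⊑S y (⊑-next _ y y∈)

      Q-tower : ∀ {S} → Tower S → Q S
      Q-tower base             = QS₀
      Q-tower (succ t)         = Q-next _ (Q-tower t)
      Q-tower (sup P ne P⊆T)   = chain-closed P ne (λ S∈P → Q-tower (P⊆T S∈P))
        λ S∈P S′∈P → tower-total (P⊆T S∈P) (P⊆T S′∈P)

      zorn : ∃[ M ] (Q M × S₀ ⊑ M × (∀ N → Q N → M ⊑ N → N ⊑ M))
      zorn = ⋃ All , Q-tower top , base-⊑ top ,
             -- The union of the tower belongs to the tower, hence so does its `next`, which is
             -- therefore contained in that union.
             next⊑⇒maximal _ (⊑-⋃ All (fromWitness (succ top)))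
        where
        All : (X → Bool) → Bool
        All S = isYes (em {P = Tower S})

        top : Tower (⋃ All)
        top = sup All (S₀ , fromWitness base) toWitness

  -- Filters, ideals and the ultrafilter theorem.

  module StoneProperties {c ℓ} (B : BooleanAlgebra c ℓ) where
    open Stone B
    open BooleanAlgebra B
      using (Carrier; _∧_; _∨_; ∨-comm; ∨-distribʳ-∧; ∨-complementˡ; ∧-complementˡ)
      renaming (⊤ to 𝟙; ⊥ to 𝟘; ¬_ to ∼_; sym to ≈-sym)
    open BooleanAlgebraProperties B
      using (∧-identityʳ; ∧-zeroˡ; ∨-identityˡ; ∨-∧-orderTheoreticLattice)
    open Lattice ∨-∧-orderTheoreticLattice
      using (_≤_; reflexive; x∧y≤x; x∧y≤y; x≤x∨y; y≤x∨y; ∧-greatest; ∨-least)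
      renaming (refl to ≤-refl; trans to ≤-trans)

    x≤𝟙 : ∀ x → x ≤ 𝟙
    x≤𝟙 x = ≈-sym (∧-identityʳ x)

    𝟘≤x : ∀ x → 𝟘 ≤ x
    𝟘≤x x = ≈-sym (∧-zeroˡ x)

    record Ideal : Set (suc (c ⊔ ℓ)) where
      field
        members    : Pred Carrier (c ⊔ ℓ)
        bottom     : 𝟘 ∈ members
        join       : ∀ {a b} → a ∈ members → b ∈ members → (a ∨ b) ∈ members
        downClosed : ∀ {a b} → a ≤ b → b ∈ members → a ∈ members
    open Ideal using (members)

    ↓ : Carrier → Ideal
    ↓ a = record
      { members    = λ x → Lift c (x ≤ a)
      ; bottom     = lift (𝟘≤x a)
      ; join       = λ (lift x≤a) (lift y≤a) → lift (∨-least x≤a y≤a)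
      ; downClosed = λ x≤y (lift y≤a) → lift (≤-trans x≤y y≤a)
      }

    Disjoint : Filter → Ideal → Set (c ⊔ ℓ)
    Disjoint F I = ∀ {a} → a ∈ ∣ F ∣ → a ∉ members I

    -- The filter generated by F and the complements of members of I.
    _∖_ : Filter → Ideal → Filter
    F ∖ I = record
      { ∣_∣      = λ x → ∃[ f ] ∃[ i ] (f ∈ ∣ F ∣ × i ∈ members I × f ≤ x ∨ i)
      ; top      = 𝟙 , 𝟘 , top , bottom , x≤x∨y 𝟙 𝟘
      ; meet     = λ (f , i , f∈F , i∈I , f≤) (g , j , g∈F , j∈I , g≤) →
          f ∧ g , i ∨ j , meet f∈F g∈F , join i∈I j∈I ,
          ≤-trans
            (∧-greatest
              (≤-trans (x∧y≤x f g) (≤-trans f≤ (∨-monoʳ (x≤x∨y i j))))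
              (≤-trans (x∧y≤y f g) (≤-trans g≤ (∨-monoʳ (y≤x∨y i j)))))
            (reflexive (≈-sym (∨-distribʳ-∧ _ _ _)))
      ; upClosed = λ x≤y (f , i , f∈F , i∈I , f≤) →
          f , i , f∈F , i∈I ,
          ≤-trans f≤ (∨-least (≤-trans x≤y (x≤x∨y _ _)) (y≤x∨y _ _))
      }
      where
      open Filter F using (top; meet)
      open Ideal I using (bottom; join)

      ∨-monoʳ : ∀ {x y z} → y ≤ z → x ∨ y ≤ x ∨ z
      ∨-monoʳ y≤z = ∨-least (x≤x∨y _ _) (≤-trans y≤z (y≤x∨y _ _))

    module _ (F : Filter) (I : Ideal) where

      ⊆-∖ : ∣ F ∣ ⊆ ∣ F ∖ I ∣
      ⊆-∖ {a} a∈F = a , 𝟘 , a∈F , Ideal.bottom I , x≤x∨y a 𝟘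

      ∼-∖ : ∀ {i} → i ∈ members I → (∼ i) ∈ ∣ F ∖ I ∣
      ∼-∖ {i} i∈I = 𝟙 , i , Filter.top F , i∈I , reflexive (≈-sym (∨-complementˡ i))

      ∖-proper : Disjoint F I → Proper (F ∖ I)
      ∖-proper F#I (f , i , f∈F , i∈I , f≤) =
        F#I f∈F (Ideal.downClosed I (≤-trans f≤ (reflexive (∨-identityˡ i))) i∈I)

    module _ (u : Ultrafilter) where
      open Ultrafilter u
      open Filter filter

      -- If `a` is not in `u`, no element of `u` lies below `a`, so adjoining `∼ a` to `u` keeps it
      -- proper, and maximality applies.
      ∖↓⊆ : ∀ {a} → a ∉ elems u → ∣ filter ∖ ↓ a ∣ ⊆ elems u
      ∖↓⊆ {a} a∉u = maximal (filter ∖ ↓ a)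
        (∖-proper filter (↓ a) λ x∈u (lift x≤a) → a∉u (upClosed x≤a x∈u))
        (⊆-∖ filter (↓ a))

      ∉⇒∼∈ : ∀ {a} → a ∉ elems u → (∼ a) ∈ elems u
      ∉⇒∼∈ {a} a∉u = ∖↓⊆ a∉u (∼-∖ filter (↓ a) (lift ≤-refl))

      ∼∈⇒∉ : ∀ {a} → (∼ a) ∈ elems u → a ∉ elems u
      ∼∈⇒∉ ∼a∈u a∈u =
        proper (upClosed (reflexive (∧-complementˡ _)) (meet ∼a∈u a∈u))

      prime : ∀ {a b} → (a ∨ b) ∈ elems u → a ∈ elems u ⊎ b ∈ elems u
      prime {a} {b} a∨b∈u with em {P = a ∈ elems u}
      ... | yes a∈u = inj₁ a∈u
      ... | no  a∉u = inj₂ (∖↓⊆ a∉u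
        (a ∨ b , a , a∨b∈u , lift ≤-refl , reflexive (∨-comm a b)))

    ultrafilter-extension : ∀ F → Proper F → Σ[ u ∈ Ultrafilter ] (∣ F ∣ ⊆ elems u)
    ultrafilter-extension F F-proper = build zorn
      where
      -- Zorn's lemma speaks of `Bool`-valued subsets, so filters enter it through their
      -- characteristic functions.
      IsProperFilter : Pred (Carrier → Bool) (suc (c ⊔ ℓ))
      IsProperFilter S = Σ[ G ∈ Filter ] (Proper G × ∣ G ∣ ≐ (T ∘ S))

      char-filter : ∀ G → Proper G → IsProperFilter (char ∣ G ∣)
      char-filter G G-proper = G , G-proper , fromWitness , toWitness

      chain-closed : ∀ P → ∃[ S ] T (P S) → (∀ {S} → T (P S) → IsProperFilter S) →
                     IsChain P → IsProperFilter (⋃ P)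
      chain-closed P (_ , S₀∈P) filters chain =
        record
          { ∣_∣      = Lift (c ⊔ ℓ) ∘ T ∘ ⋃ P
          ; top      = let (G , _ , G⊆S , _) = filters S₀∈P in
                       lift (⊑-⋃ P S₀∈P _ (G⊆S (Filter.top G)))
          ; meet     = λ (lift a∈⋃) (lift b∈⋃) →
                       let (_ , S∈P , a∈S)   = toWitness a∈⋃
                           (_ , S′∈P , b∈S′) = toWitness b∈⋃
                       in meets S∈P S′∈P a∈S b∈S′ (chain S∈P S′∈P)
          ; upClosed = λ a≤b (lift a∈⋃) →
                       let (_ , S∈P , a∈S)     = toWitness a∈⋃
                           (G , _ , G⊆S , S⊆G) = filters S∈P
                       in lift (⊑-⋃ P S∈P _ (G⊆S (Filter.upClosed G a≤b (S⊆G a∈S))))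
          } ,
        (λ (lift 𝟘∈⋃) → let (_ , S∈P , 𝟘∈S)            = toWitness 𝟘∈⋃
                            (_ , G-proper , _ , S⊆G) = filters S∈P
                        in G-proper (S⊆G 𝟘∈S)) ,
        lower , lift
        where
        meet-in : ∀ {S a b} → T (P S) → T (S a) → T (S b) →
                  Lift (c ⊔ ℓ) (T (⋃ P (a ∧ b)))
        meet-in S∈P a∈S b∈S =
          let (G , _ , G⊆S , S⊆G) = filters S∈P
          in lift (⊑-⋃ P S∈P _ (G⊆S (Filter.meet G (S⊆G a∈S) (S⊆G b∈S))))

        -- The larger of the two chain members contains both elements and is closed under meets.
        meets : ∀ {S S′ a b} → T (P S) → T (P S′) → T (S a) → T (S′ b) →
                S ⊑ S′ ⊎ S′ ⊑ S → Lift (c ⊔ ℓ) (T (⋃ P (a ∧ b)))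
        meets S∈P S′∈P a∈S b∈S′ (inj₁ S⊑S′) = meet-in S′∈P (S⊑S′ _ a∈S) b∈S′
        meets S∈P S′∈P a∈S b∈S′ (inj₂ S′⊑S) = meet-in S∈P a∈S (S′⊑S _ b∈S′)

      open Zorn IsProperFilter chain-closed (char ∣ F ∣) (char-filter F F-proper)
        using (zorn)

      build : ∃[ M ] (IsProperFilter M × char ∣ F ∣ ⊑ M ×
                      (∀ N → IsProperFilter N → M ⊑ N → N ⊑ M)) →
              Σ[ u ∈ Ultrafilter ] (∣ F ∣ ⊆ elems u)
      build (M , (G , G-proper , G⊆M , M⊆G) , F⊑M , M-max) =
        record
          { filter  = G
          ; proper  = G-proper
          ; maximal = λ H H-proper G⊆H h∈H →
              M⊆G (M-max (char ∣ H ∣) (char-filter H H-proper)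
                         (λ _ x∈M → fromWitness (G⊆H (M⊆G x∈M)))
                         _ (fromWitness h∈H))
          } ,
        λ x∈F → M⊆G (F⊑M _ (fromWitness x∈F))

    -- An ultrafilter above `F ∖ I` contains `F` and the complement of each member of `I`, hence no
    -- member itself.
    separation : ∀ F I → Disjoint F I →
                 Σ[ u ∈ Ultrafilter ] (∣ F ∣ ⊆ elems u × (∀ {i} → i ∈ members I → i ∉ elems u))
    separation F I F#I =
      let (u , F∖I⊆u) = ultrafilter-extension (F ∖ I) (∖-proper F I F#I)
      in u , (λ a∈F → F∖I⊆u (⊆-∖ F I a∈F)) , λ i∈I → ∼∈⇒∉ u (F∖I⊆u (∼-∖ F I i∈I))

    -- Closed and open sets of the Stone space, and compactness.

    φᶠ⊆φ⇒∈ : ∀ F {a} → ⟦ φᶠ F ⟧ ⊆ ⟦ φ a ⟧ → a ∈ ∣ F ∣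
    φᶠ⊆φ⇒∈ F {a} φF⊆φa = by-contradiction λ a∉F →
      let (u , F⊆u , ↓a#u) = separation F (↓ a)
            λ x∈F (lift x≤a) → a∉F (Filter.upClosed F x≤a x∈F)
      in ↓a#u (lift ≤-refl) (φF⊆φa {u} F⊆u)

    -- A point outside `φᶠ F` misses some `a` in `F`, and `φ (∼ a)` is then a neighbourhood of it
    -- disjoint from `φᶠ F`.
    φᶠ-closed : ∀ F Z → ⟦ Z ⟧ ≐ ⟦ φᶠ F ⟧ → IsClosed Z
    φᶠ-closed F Z (Z⊆φF , φF⊆Z) {u} u∉Z with em {P = ∃[ a ] (a ∈ ∣ F ∣ × a ∉ elems u)}
    ... | yes (a , a∈F , a∉u) =
      ∼ a , ∉⇒∼∈ u a∉u , λ {v} ∼a∈v v∈Z → ∼∈⇒∉ v ∼a∈v (Z⊆φF {v} v∈Z a∈F)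
    ... | no none = contradiction
      (φF⊆Z {u} λ {a} a∈F → by-contradiction λ a∉u → none (a , a∈F , a∉u)) u∉Z

    -- `Small` brings the quantification over ultrafilters, which lives one universe up, down to the
    -- level of filter predicates.
    filterOf : 𝒫Ul → Filter
    filterOf Y = record
      { ∣_∣      = λ a → Small (c ⊔ ℓ) (⟦ Y ⟧ ⊆′ ⟦ φ a ⟧)
      ; top      = toSmall λ u _ → Filter.top (Ultrafilter.filter u)
      ; meet     = λ Y⊆a Y⊆b → toSmall λ u u∈Y →
          Filter.meet (Ultrafilter.filter u) (fromSmall Y⊆a u u∈Y) (fromSmall Y⊆b u u∈Y)
      ; upClosed = λ a≤b Y⊆a → toSmall λ u u∈Y →
          Filter.upClosed (Ultrafilter.filter u) a≤b (fromSmall Y⊆a u u∈Y)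
      }

    -- If `φ a` is a neighbourhood of `u` that misses `Y`, then `∼ a` is in `filterOf Y`, so `u`
    -- cannot extend that filter.
    closed⇒≐φᶠ : ∀ Y → IsClosed Y → ⟦ Y ⟧ ≐ ⟦ φᶠ (filterOf Y) ⟧
    closed⇒≐φᶠ Y Y-closed =
      (λ {u} u∈Y Y⊆a → fromSmall Y⊆a u u∈Y) ,
      λ {u} F⊆u → by-contradiction λ u∉Y →
        let (a , a∈u , φa⊆∁Y) = Y-closed {u} u∉Y
        in ∼∈⇒∉ u
             (F⊆u (toSmall λ v v∈Y → ∉⇒∼∈ v λ a∈v → φa⊆∁Y {v} a∈v v∈Y))
             a∈u

    idealOf : 𝒫Ul → Ideal
    idealOf O = record
      { members    = λ b → Small (c ⊔ ℓ) (⟦ φ b ⟧ ⊆′ ⟦ O ⟧)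
      ; bottom     = toSmall λ u 𝟘∈u → contradiction 𝟘∈u (Ultrafilter.proper u)
      ; join       = λ φa⊆O φb⊆O → toSmall λ u a∨b∈u →
          [ fromSmall φa⊆O u , fromSmall φb⊆O u ] (prime u a∨b∈u)
      ; downClosed = λ a≤b φb⊆O → toSmall λ u a∈u →
          fromSmall φb⊆O u (Filter.upClosed (Ultrafilter.filter u) a≤b a∈u)
      }

    -- Otherwise `G` is disjoint from `idealOf O`, and the separating ultrafilter lies in `O`
    -- although no `φ b` inside `O` contains it.
    compactness : ∀ G O → IsOpen O → ⟦ φᶠ G ⟧ ⊆ ⟦ O ⟧ →
                  ∃[ b ] (b ∈ ∣ G ∣ × ⟦ φ b ⟧ ⊆ ⟦ O ⟧)
    compactness G O O-open φG⊆O = by-contradiction λ none →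
      let (u , G⊆u , I#u) = separation G (idealOf O)
            λ {b} b∈G φb⊆O → none (b , b∈G , λ {v} → fromSmall φb⊆O v)
          (b , b∈u , φb⊆O) = O-open {u} (φG⊆O {u} G⊆u)
      in I#u (toSmall λ v → φb⊆O {v}) b∈u

    ∁｛_｝ : Ultrafilter → 𝒫Ul
    ∁｛ v ｝ = record
      { ⟦_⟧  = λ w → ¬ (elems w ≐ elems v)
      ; resp = λ {w} {w′} w≈w′ w≉v w′≈v → w≉v (Setoid.trans Ul {w} {w′} {v} w≈w′ w′≈v)
      }

    -- Distinct ultrafilters differ in this direction too: if `w` had no element outside `v`,
    -- maximality of `w` would force equality.
    ∁｛｝-open : ∀ v → IsOpen ∁｛ v ｝
    ∁｛｝-open v {w} w≉v with em {P = ∃[ a ] (a ∈ elems w × a ∉ elems v)}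
    ... | yes (a , a∈w , a∉v) = a , a∈w , λ a∈x (x⊆v , _) → a∉v (x⊆v a∈x)
    ... | no  none = ⊥-elim (w≉v (w⊆v , v⊆w))
      where
      w⊆v : elems w ⊆ elems v
      w⊆v a∈w = by-contradiction λ a∉v → none (_ , a∈w , a∉v)

      v⊆w : elems v ⊆ elems w
      v⊆w = Ultrafilter.maximal w (Ultrafilter.filter v) (Ultrafilter.proper v) w⊆v

  -- The canonical extension of a conditional algebra.

  module CanonicalProperties {c ℓ} (𝔸 : ConditionalAlgebra c ℓ) where
    open ConditionalAlgebra 𝔸
    open IsConditionalAlgebra isConditionalAlgebra
    open Canonical 𝔸
    open StoneProperties booleanAlgebra
    open BooleanAlgebra booleanAlgebra
      using (_∧_) renaming (⊤ to 𝟙; refl to ≈-refl; sym to ≈-sym; trans to ≈-trans)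
    open Lattice (BooleanAlgebraProperties.∨-∧-orderTheoreticLattice booleanAlgebra)
      using (_≤_; reflexive; antisym; x∧y≤x; x∧y≤y; y≤x∨y; ∨-least)
      renaming (refl to ≤-refl; trans to ≤-trans)

    ⇒-monoʳ : ∀ {a b d} → b ≤ d → (a ⇒ b) ≤ (a ⇒ d)
    ⇒-monoʳ b≤d = ≈-trans (⇒-cong ≈-refl b≤d) (≈-sym (⇒-meet _ _ _))

    -- When `a ≤ b`, `b` equals `a ∨ b`, and `⇒-join` projects to the first factor.
    ⇒-antiˡ : ∀ {a b d} → a ≤ b → (b ⇒ d) ≤ (a ⇒ d)
    ⇒-antiˡ a≤b = ≤-trans
      (reflexive (⇒-cong (antisym (y≤x∨y _ _) (∨-least a≤b ≤-refl)) ≈-refl))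
      (≤-trans (⇒-join _ _ _) (x∧y≤x _ _))

    D-filter : Ultrafilter → Filter → Filter
    D-filter u F = record
      { ∣_∣      = D (elems u) ∣ F ∣
      ; top      = 𝟙 , F.top , u.upClosed (reflexive (≈-sym (⇒-top 𝟙))) u.top
      ; meet     = λ (a , a∈F , a⇒b∈u) (a′ , a′∈F , a′⇒b′∈u) →
          -- Antitonicity moves both conditionals to the common antecedent `a ∧ a′`, where `⇒-meet`
          -- combines them.
          a ∧ a′ , F.meet a∈F a′∈F ,
          u.upClosed (reflexive (⇒-meet _ _ _))
            (u.meet (u.upClosed (⇒-antiˡ (x∧y≤x a a′)) a⇒b∈u)
                    (u.upClosed (⇒-antiˡ (x∧y≤y a a′)) a′⇒b′∈u))
      ; upClosed = λ b≤d (a , a∈F , a⇒b∈u) → a , a∈F , u.upClosed (⇒-monoʳ b≤d) a⇒b∈u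
      }
      where
      module F = Filter F
      module u = Filter (Ultrafilter.filter u)

    ⇒ₜ⊆⇒π : ∀ U V → ⟦ U ⇒ₜ V ⟧ ⊆ ⟦ U ⇒π V ⟧
    ⇒ₜ⊆⇒π U V {u} u∈⇒ₜ Y O Y-closed Y⊆U O-open V⊆O =
      let F = filterOf Y
          -- Membership of `b` in `D` also supplies `a`, and `a` being in `filterOf Y` is exactly
          -- the bound on `Y` that is sought.
          (b , (a , Y⊆φa , a⇒b∈u) , φb⊆O) =
            compactness (D-filter u F) O (λ {v} → O-open {v})
              λ {v} D⊆v → V⊆O {v} (u∈⇒ₜ Y (λ {w} → Y⊆U {w}) {v}
                (F , closed⇒≐φᶠ Y (λ {w} → Y-closed {w}) , D⊆v))
      in a , b , (λ {v} → fromSmall Y⊆φa v) , (λ {v} → φb⊆O {v}) , a⇒b∈u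

    ⇒π⊆⇒ₜ : ∀ U V → ⟦ U ⇒π V ⟧ ⊆ ⟦ U ⇒ₜ V ⟧
    ⇒π⊆⇒ₜ U V {u} u∈⇒π Z Z⊆U {v} (F , Z≐φF , D⊆v) = by-contradiction λ v∉V →
      let (a , b , Z⊆φa , φb⊆O , a⇒b∈u) =
            u∈⇒π Z ∁｛ v ｝ (λ {w} → φᶠ-closed F Z Z≐φF {w}) (λ {w} → Z⊆U {w})
              (λ {w} → ∁｛｝-open v {w})
              (λ {w} w∈V w≈v → v∉V (resp V {w} {v} w≈v w∈V))
          a∈F = φᶠ⊆φ⇒∈ F λ {w} F⊆w → Z⊆φa {w} (proj₂ Z≐φF {w} F⊆w)
      in φb⊆O {v} (D⊆v (a , a∈F , a⇒b∈u)) (id , id)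

    module 𝒫 = BooleanAlgebra (𝒫UlAlgebra 𝒞)

    ⇒ₜ-isConditionalAlgebra : IsConditionalAlgebra (𝒫UlAlgebra 𝒞) (⇒ₜ-op 𝒞)
    ⇒ₜ-isConditionalAlgebra = record
      { ⇒-cong = λ {U} {U′} {V} {V′} (U⊆U′ , U′⊆U) (V⊆V′ , V′⊆V) →
          (λ {u} → mono U U′ V V′ (λ w → U′⊆U {w}) (λ w → V⊆V′ {w}) u) ,
          (λ {u} → mono U′ U V′ V (λ w → U⊆U′ {w}) (λ w → V′⊆V {w}) u)
      ; ⇒-top  = λ U → (λ _ → tt) , λ {u} _ → into U 𝒫.⊤ u λ _ _ _ → tt
      ; ⇒-meet = λ U V W →
          (λ {u} (p , q) → into U (V 𝒫.∧ W) u λ Z Z⊆U {v} t →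
            out U V u p Z (λ {w} → Z⊆U {w}) {v} t ,
            out U W u q Z (λ {w} → Z⊆U {w}) {v} t) ,
          λ {u} p → mono U U (V 𝒫.∧ W) V (λ _ → id) (λ _ → proj₁) u p ,
                    mono U U (V 𝒫.∧ W) W (λ _ → id) (λ _ → proj₂) u p
      -- The order is `x ≈ x ∧ y`, so the reverse inclusion is a projection and the content is
      -- antitonicity in the first argument.
      ; ⇒-join = λ U W V →
          (λ {u} p → p , mono (U 𝒫.∨ W) U V V (λ _ → inj₁) (λ _ → id) u p ,
                         mono (U 𝒫.∨ W) W V V (λ _ → inj₂) (λ _ → id) u p) ,
          proj₁
      }
      where
      into : ∀ U V u → u ∈ ⟦ U ⇒ₜ V ⟧ → u ∈ ⟦ ⇒ₜ-op 𝒞 U V ⟧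
      into U V u h = lift (fromWitness h)

      out : ∀ U V u → u ∈ ⟦ ⇒ₜ-op 𝒞 U V ⟧ → u ∈ ⟦ U ⇒ₜ V ⟧
      out U V u (lift h) = toWitness h

      mono : ∀ U U′ V V′ → ⟦ U′ ⟧ ⊆′ ⟦ U ⟧ → ⟦ V ⟧ ⊆′ ⟦ V′ ⟧ →
             ⟦ ⇒ₜ-op 𝒞 U V ⟧ ⊆′ ⟦ ⇒ₜ-op 𝒞 U′ V′ ⟧
      mono U U′ V V′ U′⊆U V⊆V′ u p =
        into U′ V′ u λ Z Z⊆U′ {v} t →
          V⊆V′ v (out U V u p Z (λ {w} w∈Z → U′⊆U w (Z⊆U′ {w} w∈Z)) {v} t)

    ⇒ₜ≐⇒π : ∀ U V → ⟦ U ⇒ₜ V ⟧ ≐ ⟦ U ⇒π V ⟧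
    ⇒ₜ≐⇒π U V = (λ {u} → ⇒ₜ⊆⇒π U V {u}) , λ {u} → ⇒π⊆⇒ₜ U V {u}

    ⇒ₜ-op≈⇒π-op : ∀ U V → ⇒ₜ-op 𝒞 U V 𝒫.≈ ⇒π-op 𝒞 U V
    ⇒ₜ-op≈⇒π-op U V =
      (λ {u} (lift h) → lift (fromWitness (⇒ₜ⊆⇒π U V {u} (toWitness h)))) ,
      λ {u} (lift h) → lift (fromWitness (⇒π⊆⇒ₜ U V {u} (toWitness h)))

theorem2p14 : (𝒞 : Classical) → ∀ {c ℓ} (𝔸 : ConditionalAlgebra c ℓ) →
    let open Canonical 𝔸 in
    (∀ (U V : 𝒫Ul) → ⟦ U ⇒ₜ V ⟧ ≐ ⟦ U ⇒π V ⟧)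
    × IsConditionalAlgebra (𝒫UlAlgebra 𝒞) (⇒ₜ-op 𝒞)
    × IsConditionalAlgebra (𝒫UlAlgebra 𝒞) (⇒π-op 𝒞)
theorem2p14 𝒞 𝔸 =
  ⇒ₜ≐⇒π ,
  ⇒ₜ-isConditionalAlgebra ,
  isConditionalAlgebra-resp (Canonical.𝒫UlAlgebra 𝔸 𝒞) ⇒ₜ-op≈⇒π-op ⇒ₜ-isConditionalAlgebra
  where open CanonicalProperties 𝒞 𝔸
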